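{- Let $c\ge 1$ be an integer and let $P$ be a set partition of $S_c$. Let $D\subseteq S_c$ be the set of permutations that are lexicographically smaller than every other permutation in their part of $P$, and let $U=S_c\setminus D$. For each positive integer $n$ let $N_n$ be the number of equivalence classes of $S_n$ under $P$-equivalence, and let $A_n$ be the number of permutations in $S_n$ that avoid every permutation in $U$. Let $k\ge 2c-1$ be an integer. If $N_k=A_k$, then $N_n=A_n$ for all $n\ge k$.
   Context: Permutations in $S_n$ are written as words $\pi_1\pi_2\cdots\pi_n$ in one-line notation. The order permutation of a word $u$ of $c$ distinct positive integers is the unique $\sigma\in S_c$ with $\sigma_i<\sigma_j$ iff $u_i<u_j$. The $P$-equivalence on $S_n$ is the equivalence relation generated by: $\phi\equiv\psi$ whenever $\phi=aub$ and $\psi=avb$ (concatenations) for some possibly empty words $a,b$ and words $u,v$ of length $c$ (so $u,v$ occupy the same $c$ consecutive positions) such that the order permutations of $u$ and $v$ lie in the same part of $P$. All equivalence classes are counted, including one-element classes. A permutation $w\in S_n$ avoids $\pi\in S_c$ if no factor of $w$ (block of letters in consecutive positions) has order permutation $\pi$; avoidance is thus in the consecutive sense. A permutation that is alone in its part of $P$ belongs to $D$. -}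

module Defs where

open import Data.Fin.Base using (Fin; zero; suc; _<_)
import Data.Fin.Base as Fin
import Data.Fin.Properties as Fin
open import Data.Fin.Permutation as Perm using (Permutation′; _⟨$⟩ʳ_; _≈_)
open import Data.List.Base as List using (List; []; _∷_; _++_; tabulate; allFin; cartesianProductWith)
import Data.List.Properties as List
import Data.List.Membership.Setoid as Membership
import Data.List.Membership.Setoid.Properties as Mem
open import Data.List.Membership.Propositional.Properties using (∈-allFin)
open import Data.List.Relation.Binary.Lex.Strict using (Lex-<; <-decidable)
open import Data.List.Relation.Unary.All as All using ([]; _∷_)
open import Data.List.Relation.Unary.AllPairs using ([]; _∷_)
open import Data.List.Relation.Unary.Any as Any using (here; there)
import Data.List.Relation.Unary.Any.Properties as Any
open import Data.List.Relation.Unary.Enumerates.Setoid using (IsEnumeration)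
import Data.List.Relation.Unary.Enumerates.Setoid.Properties as Enumerates
open import Data.List.Relation.Unary.Unique.DecSetoid.Properties using (deduplicate-!)
open import Data.List.Relation.Unary.Unique.Setoid using (Unique)
open import Data.Nat.Base using (ℕ; zero; suc)
open import Data.Product.Base using (Σ; ∃; ∃-syntax; _×_; _,_; proj₁; proj₂)
open import Data.Sum.Base using (_⊎_; inj₁; inj₂)
open import Data.Vec.Base using (Vec; []; _∷_; lookup; toList)
open import Function.Base using (_∘_)
open import Function.Bundles using (Inverse; _⇔_; mk⇔; Equivalence)
open import Level using (0ℓ)
open import Relation.Binary.Bundles using (Setoid; DecSetoid)
open import Relation.Binary.Core using (Rel; _⇒_)
open import Relation.Binary.Construct.Closure.Equivalence as Eq using (EqClosure)
open import Relation.Binary.Construct.Closure.ReflexiveTransitive using (Star; ε; _◅_; _◅◅_)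
open import Relation.Binary.Construct.Closure.Symmetric using (SymClosure; fwd; bwd)
import Relation.Binary.Construct.On as On
open import Relation.Binary.Construct.Union using (_∪_)
open import Relation.Binary.Definitions using (Decidable; DecidableEquality; _Respects_)
open import Relation.Binary.PropositionalEquality as ≡ using (_≡_; refl; sym; trans; cong)
open import Relation.Nullary using (¬_; Dec; yes; no; contradiction)
open import Relation.Nullary.Decidable using (map′; _×-dec_; _⊎-dec_; _→-dec_; ¬?)
open import Relation.Unary using (Pred)
import Relation.Unary as Unary

private
  variable
    c n : ℕ

-- S_n, with permutations compared by their values.
Sₙ : ℕ → Setoid 0ℓ 0ℓ
Sₙ n = record
  { Carrier       = Permutation′ n
  ; _≈_           = _≈_
  ; isEquivalence = record
    { refl  = λ _ → refl
    ; sym   = λ p i → sym (p i)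
    ; trans = λ p q i → trans (p i) (q i)
    }
  }

-- One-line notation, on the letters 0, …, n - 1 in place of 1, …, n.
word : Permutation′ n → List (Fin n)
word π = tabulate (π ⟨$⟩ʳ_)

_<ₗₑₓ_ : Rel (Permutation′ n) 0ℓ
π <ₗₑₓ τ = Lex-< _≡_ _<_ (word π) (word τ)

IsOrderPermutation : Permutation′ c → Vec (Fin n) c → Set
IsOrderPermutation σ u = ∀ i j → (σ ⟨$⟩ʳ i < σ ⟨$⟩ʳ j) ⇔ (lookup u i < lookup u j)

-- Sets of permutations are families of predicates closed under _≈_; every
-- partition of a finite set has finitely many parts, so they are indexed
-- by some Fin size.
record SetPartition (S : Setoid 0ℓ 0ℓ) : Set₁ where
  open Setoid S using (Carrier) renaming (_≈_ to _≈ₛ_)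
  field
    size     : ℕ
    part     : Fin size → Pred Carrier 0ℓ
    resp     : ∀ i → part i Respects _≈ₛ_
    nonempty : ∀ i → ∃[ x ] part i x
    disjoint : ∀ {i j x} → part i x → part j x → i ≡ j
    covers   : ∀ x → ∃[ i ] part i x

  SamePart : Rel Carrier 0ℓ
  SamePart x y = ∃[ i ] (part i x × part i y)

module _ (P : SetPartition (Sₙ c)) where
  open SetPartition P

  D : Pred (Permutation′ c) 0ℓ
  D π = ∀ τ → SamePart π τ → ¬ (π ≈ τ) → π <ₗₑₓ τ

  U : Pred (Permutation′ c) 0ℓ
  U π = ¬ D π

  Move : Rel (Permutation′ n) 0ℓ
  Move {n} φ ψ =
    ∃[ a ] ∃[ b ] Σ (Vec (Fin n) c) λ u → Σ (Vec (Fin n) c) λ v →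
      word φ ≡ a ++ toList u ++ b ×
      word ψ ≡ a ++ toList v ++ b ×
      (∃[ σ ] ∃[ τ ] (IsOrderPermutation σ u × IsOrderPermutation τ v × SamePart σ τ))

  -- _≈_ is included because for n < c there are no moves, and the closure
  -- on its own is then only reflexive up to _≡_, which is finer than _≈_.
  PEquivalence : Rel (Permutation′ n) 0ℓ
  PEquivalence = EqClosure (_≈_ ∪ Move)

Avoids : Permutation′ n → Permutation′ c → Set
Avoids {n} {c} w π =
  ¬ (∃[ a ] ∃[ b ] Σ (Vec (Fin n) c) λ u →
       word w ≡ a ++ toList u ++ b × IsOrderPermutation π u)

AvoidsU : SetPartition (Sₙ c) → Pred (Permutation′ n) 0ℓ
AvoidsU P w = ∀ π → U P π → Avoids w π

-- Its elements up to equality are the equivalence classes.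
Classes : SetPartition (Sₙ c) → ℕ → Setoid 0ℓ 0ℓ
Classes P n = record
  { Carrier       = Permutation′ n
  ; _≈_           = PEquivalence P
  ; isEquivalence = Eq.isEquivalence (_≈_ ∪ Move P)
  }

Avoiders : SetPartition (Sₙ c) → ℕ → Setoid 0ℓ 0ℓ
Avoiders P n = On.setoid {B = Σ (Permutation′ n) (AvoidsU P)} (Sₙ n) proj₁

Finite : Setoid 0ℓ 0ℓ → Set
Finite S = ∃[ m ] Inverse (≡.setoid (Fin m)) S

------------------------------------------------------------------------
-- Classes P n and Avoiders P n are finite, because S_n can be listed and
-- both P-equivalence and avoidance are decidable.

module _ (S : Setoid 0ℓ 0ℓ) where
  open Setoid S using (Carrier)
    renaming (_≈_ to _≈ₛ_; refl to ≈-refl; sym to ≈-sym; trans to ≈-trans)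

  lookup-injective : ∀ {xs} → Unique S xs → ∀ i j →
                     List.lookup xs i ≈ₛ List.lookup xs j → i ≡ j
  lookup-injective (_ ∷ _)  zero    zero    _ = refl
  lookup-injective (x ∷ xs) zero    (suc j) p =
    contradiction p (All.lookup x (Mem.∈-lookup (≡.setoid _) _ j))
  lookup-injective (x ∷ xs) (suc i) zero    p =
    contradiction (≈-sym p) (All.lookup x (Mem.∈-lookup (≡.setoid _) _ i))
  lookup-injective (_ ∷ xs) (suc i) (suc j) p = cong suc (lookup-injective xs i j p)

  module _ {xs : List Carrier} (_∈xs : IsEnumeration S xs) where
    open Membership S using (_∈_)

    finite : Decidable _≈ₛ_ → Finite S
    finite _≟_ = List.length ys , record
      { to        = List.lookup ys
      ; from      = index
      ; to-cong   = λ { refl → ≈-refl }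
      ; from-cong = λ {x} {y} x≈y → injective _ _
          (≈-trans (≈-sym (lookup-index x)) (≈-trans x≈y (lookup-index y)))
      ; inverse   = (λ { {x} refl → ≈-sym (lookup-index x) })
                  , (λ {i} {x} x≈i → injective _ _ (≈-trans (≈-sym (lookup-index x)) x≈i))
      }
      where
      S? : DecSetoid 0ℓ 0ℓ
      S? = record { isDecEquivalence = record
        { isEquivalence = Setoid.isEquivalence S ; _≟_ = _≟_ } }

      ys : List Carrier
      ys = List.deduplicate _≟_ xs

      _∈ys : IsEnumeration S ys
      _∈ys = Enumerates.deduplicate⁺ S? _∈xs

      index : Carrier → Fin (List.length ys)
      index x = Any.index (x ∈ys)

      lookup-index : ∀ x → x ≈ₛ List.lookup ys (index x)
      lookup-index x = Any.lookup-index (x ∈ys)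

      injective : ∀ i j → List.lookup ys i ≈ₛ List.lookup ys j → i ≡ j
      injective = lookup-injective (deduplicate-! S? xs)

    module _ {Q : Pred Carrier 0ℓ} (resp : Q Respects _≈ₛ_) (Q? : Unary.Decidable Q) where

      ∃? : Dec (∃ Q)
      ∃? = map′ Any.satisfied (λ (x , q) → Membership.lose S resp (x ∈xs) q) (Any.any? Q? xs)

      ∀? : Dec (∀ x → Q x)
      ∀? = map′ (λ all x → All.lookupₛ S resp all (x ∈xs)) (λ all → All.universal all xs) (All.all? Q? xs)

      sublist : List Carrier → List (Σ Carrier Q)
      sublist []       = []
      sublist (z ∷ zs) with Q? z
      ... | yes q = (z , q) ∷ sublist zs
      ... | no  _ = sublist zs

      ∈-sublist : ∀ {zs} (x : Σ Carrier Q) → proj₁ x ∈ zs →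
                  Membership._∈_ (On.setoid S proj₁) x (sublist zs)
      ∈-sublist {z ∷ zs} (x , q) x∈ with Q? z | x∈
      ... | yes _ | here x≈z  = here x≈z
      ... | yes _ | there x∈′ = there (∈-sublist (x , q) x∈′)
      ... | no ¬q | here x≈z  = contradiction (resp x≈z q) ¬q
      ... | no _  | there x∈′ = ∈-sublist (x , q) x∈′

    -- Warshall's algorithm: Via zs x y says that there is a path from x to y
    -- all of whose intermediate points are in zs.
    module _ {B : Rel Carrier 0ℓ} (B? : Decidable B) (≈⇒B : _≈ₛ_ ⇒ B)
             (B-respˡ : ∀ {x y z} → x ≈ₛ y → B x z → B y z)
             (B-respʳ : ∀ {x y z} → x ≈ₛ y → B z x → B z y) where

      Via : List Carrier → Rel Carrier 0ℓ
      Via []       x y = B x y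
      Via (z ∷ zs) x y = Via zs x y ⊎ (Via zs x z × Via zs z y)

      via? : ∀ zs → Decidable (Via zs)
      via? []       x y = B? x y
      via? (z ∷ zs) x y = via? zs x y ⊎-dec (via? zs x z ×-dec via? zs z y)

      via-base : ∀ zs {x y} → B x y → Via zs x y
      via-base []       b = b
      via-base (_ ∷ zs) b = inj₁ (via-base zs b)

      via-respˡ : ∀ zs {x y z} → x ≈ₛ y → Via zs x z → Via zs y z
      via-respˡ []       e p              = B-respˡ e p
      via-respˡ (_ ∷ zs) e (inj₁ p)       = inj₁ (via-respˡ zs e p)
      via-respˡ (_ ∷ zs) e (inj₂ (p , q)) = inj₂ (via-respˡ zs e p , q)

      via-respʳ : ∀ zs {x y z} → x ≈ₛ y → Via zs z x → Via zs z y
      via-respʳ []       e p              = B-respʳ e p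
      via-respʳ (_ ∷ zs) e (inj₁ p)       = inj₁ (via-respʳ zs e p)
      via-respʳ (_ ∷ zs) e (inj₂ (p , q)) = inj₂ (p , via-respʳ zs e q)

      via-trans : ∀ {zs x w y} → w ∈ zs → Via zs x w → Via zs w y → Via zs x y
      via-trans {z ∷ zs} {x} {w} {y} (here w≈z) p q = inj₂ (left p , right q)
        where
        left : Via (z ∷ zs) x w → Via zs x z
        left (inj₁ p)       = via-respʳ zs w≈z p
        left (inj₂ (p , _)) = p
        right : Via (z ∷ zs) w y → Via zs z y
        right (inj₁ q)       = via-respˡ zs w≈z q
        right (inj₂ (_ , q)) = q
      via-trans (there w∈) (inj₁ p)       (inj₁ q)       = inj₁ (via-trans w∈ p q)
      via-trans (there w∈) (inj₁ p)       (inj₂ (q , r)) = inj₂ (via-trans w∈ p q , r)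
      via-trans (there w∈) (inj₂ (p , q)) (inj₁ r)       = inj₂ (p , via-trans w∈ q r)
      via-trans (there w∈) (inj₂ (p , _)) (inj₂ (_ , q)) = inj₂ (p , q)

      via-sound : ∀ zs → Via zs ⇒ Star B
      via-sound []       b              = b ◅ ε
      via-sound (_ ∷ zs) (inj₁ p)       = via-sound zs p
      via-sound (_ ∷ zs) (inj₂ (p , q)) = via-sound zs p ◅◅ via-sound zs q

      via-complete : Star B ⇒ Via xs
      via-complete ε       = via-base xs (≈⇒B ≈-refl)
      via-complete (b ◅ p) = via-trans (_ ∈xs) (via-base xs b) (via-complete p)

      star? : Decidable (Star B)
      star? x y = map′ (via-sound xs) via-complete (via? xs x y)

module _ {A : Set} (_≟_ : DecidableEquality A) where

  prefix? : ∀ c (xs : List A) → Dec (Σ (Vec A c) λ u → ∃[ b ] xs ≡ toList u ++ b)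
  prefix? zero    xs       = yes ([] , xs , refl)
  prefix? (suc c) []       = no λ { (_ ∷ _ , _ , ()) }
  prefix? (suc c) (x ∷ xs) =
    map′ (λ { (u , b , p) → x ∷ u , b , cong (x ∷_) p })
         (λ { (_ ∷ u , b , p) → u , b , List.∷-injectiveʳ p })
         (prefix? c xs)

  prefix-unique : (u v : Vec A c) {a b : List A} →
                  toList u ++ a ≡ toList v ++ b → u ≡ v × a ≡ b
  prefix-unique []      []      p = refl , p
  prefix-unique (x ∷ u) (y ∷ v) p with refl , p′ ← List.∷-injective p
                                  with refl , q ← prefix-unique u v p′ = refl , q

  module _ {Q : Rel (Vec A c) 0ℓ} (Q? : Decidable Q) where

    SamePrefix : Rel (List A) 0ℓ
    SamePrefix xs ys = ∃[ b ] Σ (Vec A c) λ u → Σ (Vec A c) λ v →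
      xs ≡ toList u ++ b × ys ≡ toList v ++ b × Q u v

    SameContext : Rel (List A) 0ℓ
    SameContext xs ys = ∃[ a ] ∃[ b ] Σ (Vec A c) λ u → Σ (Vec A c) λ v →
      xs ≡ a ++ toList u ++ b × ys ≡ a ++ toList v ++ b × Q u v

    samePrefix? : Decidable SamePrefix
    samePrefix? xs ys with prefix? c xs | prefix? c ys
    ... | no ¬p           | _               = no λ (b , u , _ , p , _) → ¬p (u , b , p)
    ... | yes _           | no ¬q           = no λ (b , _ , v , _ , q , _) → ¬q (v , b , q)
    ... | yes (u , a , p) | yes (v , b , q) =
      map′ (λ { (refl , r) → a , u , v , p , q , r })
           unique
           (List.≡-dec _≟_ a b ×-dec Q? u v)
      where
      unique : SamePrefix xs ys → a ≡ b × Q u v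
      unique (_ , u′ , v′ , p′ , q′ , r)
        with refl , refl ← prefix-unique u u′ (trans (sym p) p′)
        with refl , refl ← prefix-unique v v′ (trans (sym q) q′) = refl , r

    sameContext? : Decidable SameContext
    sameContext? xs ys = map′ to from (samePrefix? xs ys ⊎-dec inner? xs ys)
      where
      Inner : Rel (List A) 0ℓ
      Inner xs ys = ∃[ x ] ∃[ xs′ ] ∃[ ys′ ]
        (xs ≡ x ∷ xs′ × ys ≡ x ∷ ys′ × SameContext xs′ ys′)

      inner? : Decidable Inner
      inner? []       _        = no λ { (_ , _ , _ , () , _) }
      inner? (_ ∷ _)  []       = no λ { (_ , _ , _ , _ , () , _) }
      inner? (x ∷ xs) (y ∷ ys) =
        map′ (λ { (refl , s) → x , xs , ys , refl , refl , s })
             (λ { (_ , _ , _ , refl , refl , s) → refl , s })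
             (x ≟ y ×-dec sameContext? xs ys)

      to : SamePrefix xs ys ⊎ Inner xs ys → SameContext xs ys
      to (inj₁ (b , u , v , p , q , r)) = [] , b , u , v , p , q , r
      to (inj₂ (x , _ , _ , refl , refl , a , b , u , v , p , q , r)) =
        x ∷ a , b , u , v , cong (x ∷_) p , cong (x ∷_) q , r

      from : SameContext xs ys → SamePrefix xs ys ⊎ Inner xs ys
      from ([]    , b , u , v , p , q , r) = inj₁ (b , u , v , p , q , r)
      from (x ∷ a , b , u , v , p , q , r) =
        inj₂ (x , _ , _ , p , q , a , b , u , v , refl , refl , r)

perms : ∀ n → List (Permutation′ n)
perms zero    = Perm.id ∷ []
perms (suc n) = cartesianProductWith (Perm.insert zero) (allFin (suc n)) (perms n)

insert-cong : ∀ i {j k} (π τ : Permutation′ n) → j ≡ k → π ≈ τ → Perm.insert i j π ≈ Perm.insert i k τ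
insert-cong i {j} π τ refl p x with i Fin.≟ x
... | yes _   = refl
... | no  i≢x = cong (Fin.punchIn j) (p (Fin.punchOut i≢x))

perms-enumerates : ∀ n → IsEnumeration (Sₙ n) (perms n)
perms-enumerates zero    π = here λ ()
perms-enumerates (suc n) π =
  Mem.∈-resp-≈ (Sₙ (suc n)) {x = Perm.insert zero (π ⟨$⟩ʳ zero) (Perm.remove zero π)} {π}
    (Perm.insert-remove zero π)
    (Mem.∈-cartesianProductWith⁺ (≡.setoid _) (Sₙ n) (Sₙ (suc n))
      (λ {_} {_} {π} {τ} → insert-cong zero π τ)
      (∈-allFin (π ⟨$⟩ʳ zero)) (perms-enumerates n (Perm.remove zero π)))

≈? : Decidable (_≈_ {n} {n})
≈? π τ = Fin.all? λ i → π ⟨$⟩ʳ i Fin.≟ τ ⟨$⟩ʳ i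

word-cong : (π τ : Permutation′ n) → π ≈ τ → word π ≡ word τ
word-cong π τ = List.tabulate-cong

isOrderPermutation? : (σ : Permutation′ c) (u : Vec (Fin n) c) → Dec (IsOrderPermutation σ u)
isOrderPermutation? σ u = Fin.all? λ i → Fin.all? λ j →
  map′ (λ (f , g) → mk⇔ f g) (λ e → Equivalence.to e , Equivalence.from e)
    (let p? = (σ ⟨$⟩ʳ i) Fin.<? (σ ⟨$⟩ʳ j) ; q? = lookup u i Fin.<? lookup u j
     in (p? →-dec q?) ×-dec (q? →-dec p?))

isOrderPermutation-resp : (u : Vec (Fin n) c) → (λ σ → IsOrderPermutation σ u) Respects _≈_
isOrderPermutation-resp u {σ} {τ} p f i j = ≡.subst₂ (λ a b → (a < b) ⇔ _) (p i) (p j) (f i j)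

module _ (P : SetPartition (Sₙ c)) where
  open SetPartition P

  part? : ∀ i π → Dec (part i π)
  part? i π = let j , π∈j = covers π in
    map′ (λ { refl → π∈j }) (disjoint π∈j) (j Fin.≟ i)

  samePart? : Decidable SamePart
  samePart? σ τ = Fin.any? λ i → part? i σ ×-dec part? i τ

  samePart-resp : ∀ {σ σ′ τ τ′} → σ ≈ σ′ → τ ≈ τ′ → SamePart σ τ → SamePart σ′ τ′
  samePart-resp p q (i , σ∈i , τ∈i) = i , resp i p σ∈i , resp i q τ∈i

  move? : Decidable (Move P {n})
  move? φ ψ = sameContext? Fin._≟_
    (λ u v →
      ∃? (Sₙ c) (perms-enumerates c)
        (λ {σ} {σ′} e (τ , s , t , st) → τ , isOrderPermutation-resp u {σ} {σ′} e s , t ,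
                                         samePart-resp {σ} {σ′} {τ} {τ} e (λ _ → refl) st)
        λ σ → ∃? (Sₙ c) (perms-enumerates c)
          (λ {τ} {τ′} e (s , t , st) → s , isOrderPermutation-resp v {τ} {τ′} e t ,
                                       samePart-resp {σ} {σ} {τ} {τ′} (λ _ → refl) e st)
          λ τ → isOrderPermutation? σ u ×-dec isOrderPermutation? τ v ×-dec samePart? σ τ)
    (word φ) (word ψ)

  move-resp : (φ φ′ ψ ψ′ : Permutation′ n) → φ ≈ φ′ → ψ ≈ ψ′ → Move P φ ψ → Move P φ′ ψ′
  move-resp φ φ′ ψ ψ′ e f (a , b , u , v , p , q , r) =
    a , b , u , v , trans (sym (word-cong φ φ′ e)) p , trans (sym (word-cong ψ ψ′ f)) q , r

  pEquivalence? : Decidable (PEquivalence P {n})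
  pEquivalence? {n} = star? (Sₙ n) (perms-enumerates n) step? (fwd ∘ inj₁)
      (λ {φ} {φ′} {ψ} e → λ { (fwd r) → fwd (step-resp φ φ′ ψ ψ e (λ _ → refl) r)
                            ; (bwd r) → bwd (step-resp ψ ψ φ φ′ (λ _ → refl) e r) })
      (λ {φ} {φ′} {ψ} e → λ { (fwd r) → fwd (step-resp ψ ψ φ φ′ (λ _ → refl) e r)
                            ; (bwd r) → bwd (step-resp φ φ′ ψ ψ e (λ _ → refl) r) })
    where
    Step : Rel (Permutation′ n) 0ℓ
    Step = _≈_ ∪ Move P

    step? : Decidable (SymClosure Step)
    step? φ ψ = map′ (λ { (inj₁ r) → fwd r ; (inj₂ r) → bwd r })
                     (λ { (fwd r) → inj₁ r ; (bwd r) → inj₂ r })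
                     (one? φ ψ ⊎-dec one? ψ φ)
      where
      one? : Decidable Step
      one? φ ψ = ≈? φ ψ ⊎-dec move? φ ψ

    step-resp : ∀ φ φ′ ψ ψ′ → φ ≈ φ′ → ψ ≈ ψ′ → Step φ ψ → Step φ′ ψ′
    step-resp φ φ′ ψ ψ′ e f (inj₁ r) = inj₁ λ i → trans (sym (e i)) (trans (r i) (f i))
    step-resp φ φ′ ψ ψ′ e f (inj₂ m) = inj₂ (move-resp φ φ′ ψ ψ′ e f m)

  D? : Unary.Decidable (D P)
  D? π = ∀? (Sₙ c) (perms-enumerates c) {Q = λ τ → SamePart π τ → ¬ (π ≈ τ) → π <ₗₑₓ τ}
    (λ {τ} {τ′} e f s ≉ → ≡.subst (Lex-< _≡_ _<_ (word π)) (word-cong τ τ′ e)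
      (f (samePart-resp {π} {π} {τ′} {τ} (λ _ → refl) (λ i → sym (e i)) s) (λ ≈τ → ≉ λ i → trans (≈τ i) (e i))))
    λ τ → samePart? π τ →-dec ¬? (≈? π τ) →-dec <-decidable Fin._≟_ Fin._<?_ (word π) (word τ)

  U-resp : U P Respects _≈_
  U-resp {π} {π′} e ¬d d = ¬d λ τ s ≉ → ≡.subst (λ w → Lex-< _≡_ _<_ w (word τ)) (word-cong π′ π (λ i → sym (e i)))
    (d τ (samePart-resp {π} {π′} {τ} {τ} e (λ _ → refl) s) (λ ≈τ → ≉ λ i → trans (e i) (≈τ i)))

avoids? : (w : Permutation′ n) (π : Permutation′ c) → Dec (Avoids w π)
avoids? w π = ¬? (map′
  (λ (a , b , u , _ , p , _ , r) → a , b , u , p , r)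
  (λ (a , b , u , p , r) → a , b , u , u , p , p , r)
  (sameContext? Fin._≟_ (λ u _ → isOrderPermutation? π u) (word w) (word w)))

avoidsU? : (P : SetPartition (Sₙ c)) → Unary.Decidable (AvoidsU {n = n} P)
avoidsU? {c} P w = ∀? (Sₙ c) (perms-enumerates c) {Q = λ π → U P π → Avoids w π}
  (λ {π} {π′} e f x (a , b , u , p , r) →
    let e′ = λ i → sym (e i) in f (U-resp P {π′} {π} e′ x) (a , b , u , p , isOrderPermutation-resp u {π′} {π} e′ r))
  λ π → ¬? (D? P π) →-dec avoids? w π

avoidsU-resp : (P : SetPartition (Sₙ c)) → AvoidsU {n = n} P Respects _≈_
avoidsU-resp P {w} {w′} e f π x (a , b , u , p , r) = f π x (a , b , u , trans (word-cong w w′ e) p , r)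

-- Abstract so that the counts below do not unfold to a search through perms.
abstract
  classes-finite : (P : SetPartition (Sₙ c)) (n : ℕ) → Finite (Classes P n)
  classes-finite P n = finite (Classes P n) {perms n}
    (λ φ → Any.map (λ e → fwd (inj₁ e) ◅ ε) (perms-enumerates n φ)) (pEquivalence? P)

  avoiders-finite : (P : SetPartition (Sₙ c)) (n : ℕ) → Finite (Avoiders P n)
  avoiders-finite P n = finite (Avoiders P n)
    {sublist (Sₙ n) (perms-enumerates n) {AvoidsU P} (λ {w} {w′} → avoidsU-resp P {w} {w′}) (avoidsU? P) (perms n)}
    (λ w → ∈-sublist (Sₙ n) (perms-enumerates n) (λ {w} {w′} → avoidsU-resp P {w} {w′}) (avoidsU? P) w (perms-enumerates n (proj₁ w)))
    (λ w x → ≈? (proj₁ w) (proj₁ x))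

------------------------------------------------------------------------
-- Cardinalities, which do not depend on the bijections chosen above.

numClasses : SetPartition (Sₙ c) → ℕ → ℕ
numClasses P n = proj₁ (classes-finite P n)

numAvoiders : SetPartition (Sₙ c) → ℕ → ℕ
numAvoiders P n = proj₁ (avoiders-finite P n)

{-# OPTIONS --safe #-}
module Submission where

-- Orient every move so that it replaces a factor by a lexicographically
-- smaller one: w ⟶ w′ when w′ arises from w by replacing a factor with pattern
-- σ by the arrangement of the same letters with pattern τ, where σ and τ lie in
-- one part of P and τ is lexicographically smaller than σ.  Each step makes the
-- word lexicographically smaller, so rewriting terminates.  A pattern lies in U
-- exactly when some pattern of its part is smaller, so the normal forms among
-- the permutations are exactly those that avoid U, and every P-class contains
-- one (normalize).  Hence sending an avoider to its class is a surjection
-- between finite sets, and N_n = A_n says that it is injective, which is to say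
-- that normal forms are unique.  For a terminating relation this amounts to
-- confluence (sameCount⇒confluent, confluent⇒sameCount).
--
-- It remains to carry confluence from length n to length n + 1 when
-- 2c - 1 ≤ n (confluent-suc).  By Newman's lemma local confluence is enough.  Take
-- two steps from one permutation of length n + 1.  If both windows miss the
-- first letter, delete that letter and standardize, join the two results by
-- confluence in length n, and put the letter back; similarly for the last
-- letter.  Otherwise one window is at the very beginning and the other at the
-- very end, and since 2c ≤ n + 1 they do not overlap, so the two steps commute.
--
-- Words are lists, and a factor with pattern σ is written spell e σ, where the
-- strictly increasing map e lists its letters in order.  The map e depends only
-- on the set of letters (monotone-unique); this is why a Move, which only says
-- that both words are permutations and agree outside the window, is a step in
-- one direction or the other, or trivial.

open import Defs
open import Data.Nat.Base as ℕ using (ℕ; zero; suc; _≤_; _+_; _*_; _∸_; _^_)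
import Data.Nat.Properties as ℕ
open import Data.Nat.Induction using (<-wellFounded)
open import Data.Fin.Base as Fin using (Fin; zero; suc; toℕ; punchIn; punchOut; fromℕ; _<_)
import Data.Fin.Properties as Fin
open import Data.Fin.Permutation as Perm using
  ( Permutation′; _⟨$⟩ʳ_; _⟨$⟩ˡ_; _≈_; inverseˡ; inverseʳ )
open import Data.List.Base as List using
  ( List; []; _∷_; _++_; _∷ʳ_; [_]; map; tabulate; allFin; length; initLast; _∷ʳ′_ )
import Data.List.Properties as List
open import Data.List.Membership.Propositional using (_∈_)
open import Data.List.Membership.Propositional.Properties using (∈-tabulate⁺; ∈-tabulate⁻; ∈-allFin)
open import Data.List.Membership.Propositional.Properties.WithK using (unique∧set⇒bag)
open import Data.List.Relation.Binary.BagAndSetEquality using (∼bag⇒↭)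
open import Data.List.Relation.Binary.Lex.Strict using
  ( Lex-<; halt; this; next; <-compare; <-decidable; <-asymmetric )
open import Data.List.Relation.Binary.Permutation.Propositional using (_↭_; ↭-sym; ↭-trans; ↭⇒↭ₛ)
import Data.List.Relation.Binary.Permutation.Propositional.Properties as ↭
open import Data.List.Relation.Binary.Pointwise using (Pointwise-≡⇒≡)
import Data.List.Relation.Unary.AllPairs.Properties as AllPairs
open import Data.List.Relation.Unary.Sorted.TotalOrder.Properties using (↗↭↗⇒≋; AllPairs⇒Sorted)
import Data.List.Relation.Unary.Unique.Propositional.Properties as Unique
open import Data.Product.Base using (Σ; ∃; ∃-syntax; _×_; _,_; proj₁; proj₂)
open import Data.Sum.Base using (_⊎_; inj₁; inj₂)
open import Data.Vec.Base as Vec using (Vec; []; _∷_; lookup; toList)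
import Data.Vec.Properties as Vec
open import Function.Base using (_∘_; flip)
open import Function.Bundles using (Inverse; _⇔_; mk⇔; Equivalence)
import Induction.WellFounded as WF
open import Level using (0ℓ)
open import Relation.Binary.Bundles using (Setoid)
open import Relation.Binary.Core using (Rel)
open import Relation.Binary.Construct.Closure.Equivalence as Eq using (EqClosure)
open import Relation.Binary.Construct.Closure.Equivalence.Properties using (a—↠b⇒a↔b)
open import Relation.Binary.Construct.Closure.ReflexiveTransitive as Star using (Star; ε; _◅_)
open import Relation.Binary.Construct.Closure.Symmetric using (fwd; bwd)
open import Relation.Binary.Construct.Closure.Transitive using (Plus; _∼⁺⟨_⟩_)
import Relation.Binary.Construct.On as On
open import Relation.Binary.Definitions using (tri<; tri≈; tri>)
open import Relation.Binary.PropositionalEquality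
  using (_≡_; _≢_; refl; sym; trans; cong; subst; subst₂; module ≡-Reasoning)
open import Relation.Binary.Rewriting using
  ( IsNormalForm; HasNormalForm; WeaklyNormalizing; StronglyNormalizing; UniqueNormalForm
  ; Confluent; WeaklyConfluent; conf⇒unf; un&wn⇒cr; sn&wcr⇒cr )
open import Relation.Nullary using (¬_; Dec; yes; no; contradiction)
open import Relation.Nullary.Decidable using (map′; _×-dec_; ¬?)

private
  variable
    A B : Set
    c m n : ℕ

-- Counting finite setoids

rightInverse⇒leftInverse : (f g : Fin n → Fin n) → (∀ j → f (g j) ≡ j) → ∀ i → g (f i) ≡ i
rightInverse⇒leftInverse {suc n} f g fg i with g (f i) Fin.≟ i
... | yes p = p
... | no ¬p = contradiction (Fin.injective⇒≤ {f = λ j → punchOut (i≢g j)} injective) (ℕ.<⇒≱ ℕ.≤-refl)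
  where
  i≢g : ∀ j → i ≢ g j
  i≢g j i≡gj = ¬p (trans (cong (g ∘ f) i≡gj) (trans (cong g (fg j)) (sym i≡gj)))

  injective : ∀ {j k} → punchOut (i≢g j) ≡ punchOut (i≢g k) → j ≡ k
  injective {j} {k} e = trans (sym (fg j))
    (trans (cong f (Fin.punchOut-injective (i≢g j) (i≢g k) e)) (fg k))

-- For a map f with a section g between finite setoids, equal cardinalities
-- and injectivity of f are equivalent.  The section need not respect the
-- equivalence of T: it is used only through enumerating representatives.
module _ {S T : Setoid 0ℓ 0ℓ} where
  private
    module S = Setoid S
    module T = Setoid T

  module _ (finS : Finite S) (finT : Finite T)
           (f : S.Carrier → T.Carrier) (f-cong : ∀ {x y} → x S.≈ y → f x T.≈ f y)
           (g : T.Carrier → S.Carrier) (fg : ∀ y → f (g y) T.≈ y) where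
    private
      module I = Inverse (proj₂ finS)
      module J = Inverse (proj₂ finT)

      F : Fin (proj₁ finS) → Fin (proj₁ finT)
      F = J.from ∘ f ∘ I.to

      G : Fin (proj₁ finT) → Fin (proj₁ finS)
      G = I.from ∘ g ∘ J.to

      FG : ∀ j → F (G j) ≡ j
      FG j = J.inverseʳ (T.trans (f-cong (I.strictlyInverseˡ (g (J.to j)))) (fg (J.to j)))

      F-from : ∀ x → F (I.from x) ≡ J.from (f x)
      F-from x = J.from-cong (f-cong (I.strictlyInverseˡ x))

    sameSize⇒injective : proj₁ finT ≡ proj₁ finS → ∀ {x y} → f x T.≈ f y → x S.≈ y
    sameSize⇒injective eq {x} {y} fx≈fy =
      S.trans (S.sym (I.strictlyInverseˡ x))
        (S.trans (S.reflexive (cong I.to from≡)) (I.strictlyInverseˡ y))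
      where
      -- rightInverse⇒leftInverse, with the two sizes free to be identified.
      leftInverse : ∀ {l m} → l ≡ m → (F : Fin m → Fin l) (G : Fin l → Fin m) →
                    (∀ j → F (G j) ≡ j) → ∀ i → G (F i) ≡ i
      leftInverse refl = rightInverse⇒leftInverse

      GF : ∀ i → G (F i) ≡ i
      GF = leftInverse eq F G FG

      from≡ : I.from x ≡ I.from y
      from≡ = begin
        I.from x              ≡⟨ GF (I.from x) ⟨
        G (F (I.from x))      ≡⟨ cong G (F-from x) ⟩
        G (J.from (f x))      ≡⟨ cong G (J.from-cong fx≈fy) ⟩
        G (J.from (f y))      ≡⟨ cong G (F-from y) ⟨
        G (F (I.from y))      ≡⟨ GF (I.from y) ⟩
        I.from y              ∎
        where open ≡-Reasoning

    injective⇒sameSize : (∀ {x y} → f x T.≈ f y → x S.≈ y) → proj₁ finT ≡ proj₁ finS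
    injective⇒sameSize f-inj = Fin.cantor-schröder-bernstein {f = G} {g = F} G-inj F-inj
      where
      G-inj : ∀ {i j} → G i ≡ G j → i ≡ j
      G-inj {i} {j} e = trans (sym (FG i)) (trans (cong F e) (FG j))

      F-inj : ∀ {i j} → F i ≡ F j → i ≡ j
      F-inj {i} {j} e = trans (sym (I.strictlyInverseʳ i))
        (trans (I.from-cong (f-inj f≈)) (I.strictlyInverseʳ j))
        where
        f≈ : f (I.to i) T.≈ f (I.to j)
        f≈ = T.trans (T.sym (J.strictlyInverseˡ _))
          (T.trans (T.reflexive (cong J.to e)) (J.strictlyInverseˡ _))

-- Words

tabulate-injective : {f g : Fin n → A} → tabulate f ≡ tabulate g → ∀ i → f i ≡ g i
tabulate-injective e zero    = List.∷-injectiveˡ e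
tabulate-injective e (suc i) = tabulate-injective (List.∷-injectiveʳ e) i

-- punchIn (fromℕ n) skips the last index, so it is the embedding of the
-- first n indices.
tabulate-∷ʳ : (f : Fin (suc n) → A) →
              tabulate f ≡ tabulate (λ i → f (punchIn (fromℕ n) i)) ∷ʳ f (fromℕ n)
tabulate-∷ʳ {n = zero}  f = refl
tabulate-∷ʳ {n = suc n} f = cong (f zero ∷_) (tabulate-∷ʳ (f ∘ suc))

map≡++ : (f : A → B) (xs : List A) (ys : List B) {zs : List B} → map f xs ≡ ys ++ zs →
         ∃[ as ] ∃[ bs ] xs ≡ as ++ bs × ys ≡ map f as × zs ≡ map f bs
map≡++ f xs       []       refl = [] , xs , refl , refl , refl
map≡++ f (x ∷ xs) (y ∷ ys) e with refl , e′ ← List.∷-injective e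
                             with as , bs , refl , refl , refl ← map≡++ f xs ys e′
  = x ∷ as , bs , refl , refl , refl

map≡tabulate : (f : A → B) (xs : List A) (g : Fin n → B) → map f xs ≡ tabulate g →
               Σ (Fin n → A) λ h → xs ≡ tabulate h × (∀ i → f (h i) ≡ g i)
map≡tabulate {n = zero}  f []       g e = (λ ()) , refl , λ ()
map≡tabulate {n = suc n} f (x ∷ xs) g e
  with h , refl , fh ← map≡tabulate f xs (g ∘ suc) (List.∷-injectiveʳ e) =
  (λ { zero → x ; (suc i) → h i }) , refl , λ { zero → List.∷-injectiveˡ e ; (suc i) → fh i }

++≡++ : (as bs : List A) {cs ds : List A} → length as ≤ length bs → as ++ cs ≡ bs ++ ds →
        ∃[ ms ] bs ≡ as ++ ms × cs ≡ ms ++ ds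
++≡++ []       bs       _         e = bs , refl , e
++≡++ (a ∷ as) (b ∷ bs) (ℕ.s≤s l) e
  with refl , e′ ← List.∷-injective e
  with ms , refl , refl ← ++≡++ as bs l e′ = ms , refl , refl

++-cancelˡ-↭ : (as : List A) {xs ys : List A} → as ++ xs ↭ as ++ ys → xs ↭ ys
++-cancelˡ-↭ []       p = p
++-cancelˡ-↭ (a ∷ as) p = ++-cancelˡ-↭ as (↭.drop-∷ p)

-- If two words are rearrangements of each other and agree outside a window,
-- then their factors in that window are rearrangements of each other.
infix-↭ : (as : List A) {xs ys bs : List A} → as ++ xs ++ bs ↭ as ++ ys ++ bs → xs ↭ ys
infix-↭ as {xs} {ys} {bs} p = ++-cancelˡ-↭ bs
  (↭-trans (↭.++-comm bs xs) (↭-trans (++-cancelˡ-↭ as p) (↭.++-comm ys bs)))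

word-↭ : (π : Permutation′ n) → word π ↭ allFin n
word-↭ π = ∼bag⇒↭ (unique∧set⇒bag
  (Unique.tabulate⁺ λ {i} {j} e → trans (sym (inverseˡ π)) (trans (cong (π ⟨$⟩ˡ_) e) (inverseˡ π)))
  (Unique.allFin⁺ _)
  λ {x} → mk⇔ (λ _ → ∈-allFin x)
              (λ _ → subst (_∈ word π) (inverseʳ π) (∈-tabulate⁺ (π ⟨$⟩ˡ x))))

-- Every arrangement of the n letters is the one-line notation of a permutation.
↭-word : {w : List (Fin n)} → w ↭ allFin n → ∃[ π ] word π ≡ w
↭-word {n} {w} p = let f , w≡f = asTabulate w (trans (↭.↭-length p) (List.length-tabulate _))
                   in fromTabulate f w≡f
  where
  asTabulate : ∀ {m} (xs : List A) → length xs ≡ m → Σ (Fin m → A) λ f → xs ≡ tabulate f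
  asTabulate xs refl = List.lookup xs , sym (List.tabulate-lookup xs)

  fromTabulate : (f : Fin n → Fin n) → w ≡ tabulate f → ∃[ π ] word π ≡ w
  fromTabulate f refl = Perm.permutation f g fg (rightInverse⇒leftInverse f g fg) , refl
    where
    preimage : ∀ j → ∃[ i ] j ≡ f i
    preimage j = ∈-tabulate⁻ (↭.∈-resp-↭ (↭-sym p) (∈-allFin j))
    g : Fin n → Fin n
    g = proj₁ ∘ preimage
    fg : ∀ j → f (g j) ≡ j
    fg j = sym (proj₂ (preimage j))

word-injective : (π τ : Permutation′ n) → word π ≡ word τ → π ≈ τ
word-injective π τ = tabulate-injective

-- Deleting the first or the last letter x and standardizing the rest: what
-- remains is the image of the smaller permutation under punchIn x.
word-remove-first : (π : Permutation′ (suc n)) →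
  word π ≡ (π ⟨$⟩ʳ zero) ∷ map (punchIn (π ⟨$⟩ʳ zero)) (word (Perm.remove zero π))
word-remove-first π = cong ((π ⟨$⟩ʳ zero) ∷_) (trans (List.tabulate-cong (Perm.punchIn-permute π zero))
  (sym (List.map-tabulate _ _)))

word-remove-last : (π : Permutation′ (suc n)) →
  word π ≡ map (punchIn (π ⟨$⟩ʳ fromℕ n)) (word (Perm.remove (fromℕ n) π)) ∷ʳ (π ⟨$⟩ʳ fromℕ n)
word-remove-last {n} π = trans (tabulate-∷ʳ (π ⟨$⟩ʳ_)) (cong (_∷ʳ (π ⟨$⟩ʳ fromℕ n))
  (trans (List.tabulate-cong (Perm.punchIn-permute π (fromℕ n))) (sym (List.map-tabulate _ _))))

-- Strictly monotone maps

-- e is strictly increasing.  The indices are explicit because i < j, a statement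
-- about natural numbers, does not determine them.
Monotone : (Fin m → Fin n) → Set
Monotone e = ∀ i j → i < j → e i < e j

monotone-reflects : (e : Fin m → Fin n) → Monotone e → ∀ i j → e i < e j → i < j
monotone-reflects e mono i j p with Fin.<-cmp i j
... | tri< i<j _ _ = i<j
... | tri≈ _ refl _ = contradiction p (ℕ.<-irrefl refl)
... | tri> _ _ j<i = contradiction p (ℕ.<-asym (mono j i j<i))

punchIn-monotone : (x : Fin (suc n)) → Monotone (punchIn x)
punchIn-monotone x i j i<j = Fin.≤∧≢⇒< (Fin.punchIn-mono-≤ x i j (ℕ.<⇒≤ i<j))
  (λ e → Fin.<⇒≢ i<j (Fin.punchIn-injective x i j e))

-- A strictly increasing map is determined by its set of values, which it
-- lists in sorted order.
monotone-unique : (e f : Fin m → Fin n) → Monotone e → Monotone f →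
                  tabulate e ↭ tabulate f → ∀ i → e i ≡ f i
monotone-unique {n = n} e f e-mono f-mono p = tabulate-injective (Pointwise-≡⇒≡
  (↗↭↗⇒≋ O (sorted e e-mono) (sorted f f-mono) (↭⇒↭ₛ p)))
  where
  O = Fin.≤-totalOrder n
  sorted : ∀ g → Monotone g → _
  sorted g g-mono = AllPairs⇒Sorted O (AllPairs.tabulate⁺-< (λ {i} {j} i<j → ℕ.<⇒≤ (g-mono i j i<j)))

-- Lexicographic order

-- The lexicographic order that compares one-line notations, on arbitrary words.
infix 4 _<ₗ_

_<ₗ_ : Rel (List (Fin n)) 0ℓ
_<ₗ_ = Lex-< _≡_ _<_

<ₗ-map : (e : Fin m → Fin n) → Monotone e → ∀ {xs ys} → xs <ₗ ys → map e xs <ₗ map e ys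
<ₗ-map e mono halt        = halt
<ₗ-map e mono (this x<y)  = this (mono _ _ x<y)
<ₗ-map e mono (next x≡y p) = next (cong e x≡y) (<ₗ-map e mono p)

<ₗ-++ˡ : (as : List (Fin n)) {xs ys : List (Fin n)} → xs <ₗ ys → as ++ xs <ₗ as ++ ys
<ₗ-++ˡ []       p = p
<ₗ-++ˡ (a ∷ as) p = next refl (<ₗ-++ˡ as p)

<ₗ-++ʳ : {xs ys bs : List (Fin n)} → length xs ≡ length ys → xs <ₗ ys → xs ++ bs <ₗ ys ++ bs
<ₗ-++ʳ l (this x<y)   = this x<y
<ₗ-++ʳ l (next x≡y p) = next x≡y (<ₗ-++ʳ (ℕ.suc-injective l) p)

-- A word over n letters read as a numeral in base n; on words of equal length
-- it is strictly monotone for the lexicographic order.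
value : List (Fin n) → ℕ
value         []       = 0
value {n = n} (x ∷ xs) = toℕ x * n ^ length xs + value xs

value-bound : (xs : List (Fin n)) → value xs ℕ.< n ^ length xs
value-bound         []       = ℕ.≤-refl
value-bound {n = n} (x ∷ xs) = begin-strict
  toℕ x * N + value xs  <⟨ ℕ.+-monoʳ-< (toℕ x * N) (value-bound xs) ⟩
  toℕ x * N + N         ≡⟨ ℕ.+-comm (toℕ x * N) N ⟩
  suc (toℕ x) * N       ≤⟨ ℕ.*-monoˡ-≤ N (Fin.toℕ<n x) ⟩
  n * N                 ∎
  where
  open ℕ.≤-Reasoning
  N = n ^ length xs

value-< : {xs ys : List (Fin n)} → length xs ≡ length ys → xs <ₗ ys → value xs ℕ.< value ys
value-< {n = n} l (this {x} {xs} {y} {ys} x<y) = begin-strict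
  toℕ x * n ^ length xs + value xs  ≡⟨ cong (λ k → toℕ x * n ^ k + value xs) (ℕ.suc-injective l) ⟩
  toℕ x * N + value xs              <⟨ ℕ.+-monoʳ-< (toℕ x * N) bound ⟩
  toℕ x * N + N                     ≡⟨ ℕ.+-comm (toℕ x * N) N ⟩
  suc (toℕ x) * N                   ≤⟨ ℕ.*-monoˡ-≤ N x<y ⟩
  toℕ y * N                         ≤⟨ ℕ.m≤m+n (toℕ y * N) (value ys) ⟩
  toℕ y * N + value ys              ∎
  where
  open ℕ.≤-Reasoning
  N = n ^ length ys
  bound : value xs ℕ.< N
  bound = subst (λ k → value xs ℕ.< n ^ k) (ℕ.suc-injective l) (value-bound xs)

value-< {n = n} l (next {x} {xs} {.x} {ys} refl p) =
  subst (λ k → toℕ x * n ^ k + value xs ℕ.< toℕ x * n ^ length ys + value ys) (sym (ℕ.suc-injective l))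
    (ℕ.+-monoʳ-< (toℕ x * n ^ length ys) (value-< (ℕ.suc-injective l) p))

-- Factors with a given pattern

-- The factor with pattern σ whose letters, in increasing order, are
-- e 0, e 1, ….
spell : (Fin c → Fin n) → Permutation′ c → List (Fin n)
spell e σ = tabulate (λ i → e (σ ⟨$⟩ʳ i))

spell≡map : (e : Fin c → Fin n) (σ : Permutation′ c) → spell e σ ≡ map e (word σ)
spell≡map e σ = sym (List.map-tabulate (σ ⟨$⟩ʳ_) e)

spell-↭ : (e : Fin c → Fin n) (σ : Permutation′ c) → spell e σ ↭ tabulate e
spell-↭ e σ = subst₂ _↭_ (sym (spell≡map e σ)) (List.map-tabulate _ e) (↭.map⁺ e (word-↭ σ))

length-spell : (e : Fin c → Fin n) (σ : Permutation′ c) → length (spell e σ) ≡ c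
length-spell e σ = List.length-tabulate _

toList-tabulate : (f : Fin n → A) → toList (Vec.tabulate f) ≡ tabulate f
toList-tabulate {n = zero}  f = refl
toList-tabulate {n = suc n} f = cong (f zero ∷_) (toList-tabulate (f ∘ suc))

-- A word has order permutation σ exactly when it is spell e σ for some strictly
-- increasing e.
spell⇒orderPermutation : (e : Fin c → Fin n) → Monotone e → (σ : Permutation′ c) →
  Σ (Vec (Fin n) c) λ u → toList u ≡ spell e σ × IsOrderPermutation σ u
spell⇒orderPermutation e mono σ = Vec.tabulate f , toList-tabulate f , λ i j →
  subst₂ (λ x y → (σ ⟨$⟩ʳ i < σ ⟨$⟩ʳ j) ⇔ (x < y))
    (sym (Vec.lookup∘tabulate f i)) (sym (Vec.lookup∘tabulate f j))
    (mk⇔ (mono _ _) (monotone-reflects e mono _ _))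
  where
  f = λ i → e (σ ⟨$⟩ʳ i)

orderPermutation⇒spell : (σ : Permutation′ c) (u : Vec (Fin n) c) → IsOrderPermutation σ u →
  Σ (Fin c → Fin n) λ e → Monotone e × toList u ≡ spell e σ
orderPermutation⇒spell σ u ord = e , mono , (begin
  toList u                           ≡⟨ cong toList (Vec.tabulate∘lookup u) ⟨
  toList (Vec.tabulate (lookup u))   ≡⟨ toList-tabulate (lookup u) ⟩
  tabulate (lookup u)                ≡⟨ List.tabulate-cong (λ i → cong (lookup u) (inverseˡ σ)) ⟨
  spell e σ                          ∎)
  where
  open ≡-Reasoning
  e = λ i → lookup u (σ ⟨$⟩ˡ i)
  mono : Monotone e
  mono i j i<j = Equivalence.to (ord _ _) (subst₂ _<_ (sym (inverseʳ σ)) (sym (inverseʳ σ)) i<j)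

-- Patterns and their parts

<ₗₑₓ-compare : (σ τ : Permutation′ c) → σ <ₗₑₓ τ ⊎ σ ≈ τ ⊎ τ <ₗₑₓ σ
<ₗₑₓ-compare σ τ with <-compare sym Fin.<-cmp (word σ) (word τ)
... | tri< σ<τ _ _ = inj₁ σ<τ
... | tri≈ _ σ≈τ _ = inj₂ (inj₁ (word-injective σ τ (Pointwise-≡⇒≡ σ≈τ)))
... | tri> _ _ τ<σ = inj₂ (inj₂ τ<σ)

<ₗₑₓ-asym : {σ τ : Permutation′ c} → σ <ₗₑₓ τ → ¬ (τ <ₗₑₓ σ)
<ₗₑₓ-asym = <-asymmetric sym ((λ { refl p → p }) , (λ { refl p → p })) ℕ.<-asym

-- A window at most half as long as the word does not cover it.
2*m≤1+n⇒m<1+n : ∀ m → 2 * m ≤ suc n → m ℕ.< suc n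
2*m≤1+n⇒m<1+n zero    _ = ℕ.z<s
2*m≤1+n⇒m<1+n (suc m) p = ℕ.<-≤-trans (ℕ.m<m+n (suc m) ℕ.z<s) p

module _ {c : ℕ} (P : SetPartition (Sₙ c)) where
  open SetPartition P

  SamePart-sym : ∀ {σ τ} → SamePart σ τ → SamePart τ σ
  SamePart-sym (i , s , t) = i , t , s

  -- The witness is found by searching the finitely many patterns; if there is
  -- none, totality of the lexicographic order puts σ in D.
  U⇒smaller : ∀ σ → U P σ → ∃[ τ ] SamePart σ τ × τ <ₗₑₓ σ
  U⇒smaller σ σ∈U with ∃? (Sₙ c) (perms-enumerates c) {Q = λ τ → SamePart σ τ × τ <ₗₑₓ σ}
    (λ {τ} {τ′} e (s , l) → samePart-resp P {σ} {σ} {τ} {τ′} (λ _ → refl) e s ,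
      subst (λ w → Lex-< _≡_ _<_ w (word σ)) (word-cong τ τ′ e) l)
    (λ τ → samePart? P σ τ ×-dec <-decidable Fin._≟_ Fin._<?_ (word τ) (word σ))
  ... | yes p = p
  ... | no ¬p = contradiction σ∈D σ∈U
    where
    σ∈D : D P σ
    σ∈D τ s σ≉τ with <ₗₑₓ-compare σ τ
    ... | inj₁ σ<τ = σ<τ
    ... | inj₂ (inj₁ σ≈τ) = contradiction σ≈τ σ≉τ
    ... | inj₂ (inj₂ τ<σ) = contradiction (τ , s , τ<σ) ¬p

  smaller⇒U : ∀ {σ τ} → SamePart σ τ → τ <ₗₑₓ σ → U P σ
  smaller⇒U {σ} {τ} s τ<σ σ∈D = <ₗₑₓ-asym {σ = σ} {τ = τ} (σ∈D τ s σ≉τ) τ<σ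
    where
    σ≉τ : ¬ (σ ≈ τ)
    σ≉τ e = <ₗₑₓ-asym {σ = τ} {τ = σ} τ<σ
      (subst₂ (Lex-< _≡_ _<_) (word-cong τ σ (sym ∘ e)) (word-cong σ τ e) τ<σ)

  -- Oriented moves

  -- u and v spell patterns of one part of P with the same letters, and v is
  -- the lexicographically smaller of the two.
  Contract : Rel (List (Fin n)) 0ℓ
  Contract {n} u v = ∃[ σ ] ∃[ τ ] Σ (Fin c → Fin n) λ e →
    Monotone e × SamePart σ τ × τ <ₗₑₓ σ × u ≡ spell e σ × v ≡ spell e τ

  contract-lengthˡ : {u v : List (Fin n)} → Contract u v → length u ≡ c
  contract-lengthˡ (σ , _ , e , _ , _ , _ , refl , _) = length-spell e σ

  contract-↭ : {u v : List (Fin n)} → Contract u v → u ↭ v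
  contract-↭ (σ , τ , e , _ , _ , _ , refl , refl) = ↭-trans (spell-↭ e σ) (↭-sym (spell-↭ e τ))

  contract-lex : {u v : List (Fin n)} → Contract u v → v <ₗ u
  contract-lex (σ , τ , e , mono , _ , τ<σ , refl , refl) =
    subst₂ _<ₗ_ (sym (spell≡map e τ)) (sym (spell≡map e σ)) (<ₗ-map e mono τ<σ)

  contract-map : (g : Fin m → Fin n) → Monotone g →
                 ∀ {u v} → Contract u v → Contract (map g u) (map g v)
  contract-map g g-mono (σ , τ , e , mono , s , l , refl , refl) =
    σ , τ , g ∘ e , (λ i j i<j → g-mono _ _ (mono i j i<j)) , s , l ,
    List.map-tabulate _ g , List.map-tabulate _ g

  -- The target of a contraction uses no new letters, so it lies in the range of
  -- g whenever the source does.
  contract-unmap : (g : Fin m → Fin n) → Monotone g → ∀ u {v} → Contract (map g u) v →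
                   ∃[ v′ ] v ≡ map g v′ × Contract u v′
  contract-unmap {m = m} g g-mono u (σ , τ , e , mono , s , l , gu≡ , refl)
    with h , u≡h , gh ← map≡tabulate g u _ gu≡ =
    spell e′ τ , v≡ , σ , τ , e′ , mono′ , s , l , u≡ , refl
    where
    e′ : Fin c → Fin m
    e′ i = h (σ ⟨$⟩ˡ i)

    ge′ : ∀ i → g (e′ i) ≡ e i
    ge′ i = trans (gh (σ ⟨$⟩ˡ i)) (cong e (inverseʳ σ))

    mono′ : Monotone e′
    mono′ i j i<j = monotone-reflects g g-mono _ _
      (subst₂ _<_ (sym (ge′ i)) (sym (ge′ j)) (mono i j i<j))

    u≡ : u ≡ spell e′ σ
    u≡ = trans u≡h (List.tabulate-cong λ i → cong h (sym (inverseˡ σ)))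

    v≡ : spell e τ ≡ map g (spell e′ τ)
    v≡ = trans (List.tabulate-cong λ i → sym (ge′ (τ ⟨$⟩ʳ i))) (sym (List.map-tabulate _ g))

  infix 4 _⟶_ _⇒_ _—↠_ _↔_

  -- One oriented move, on arbitrary words.
  _⟶_ : Rel (List (Fin n)) 0ℓ
  w ⟶ w′ = ∃[ a ] ∃[ b ] ∃[ u ] ∃[ v ] w ≡ a ++ u ++ b × w′ ≡ a ++ v ++ b × Contract u v

  ⟶-↭ : {w w′ : List (Fin n)} → w ⟶ w′ → w ↭ w′
  ⟶-↭ (a , b , u , v , refl , refl , con) = ↭.++⁺ˡ a (↭.++⁺ʳ b (contract-↭ con))

  ⟶-value : {w w′ : List (Fin n)} → w ⟶ w′ → value w′ ℕ.< value w
  ⟶-value {w = w} r@(a , b , u , v , refl , refl , con) = value-< (↭.↭-length (↭-sym (⟶-↭ r)))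
    (<ₗ-++ˡ a (<ₗ-++ʳ (↭.↭-length (↭-sym (contract-↭ con))) (contract-lex con)))

  ⟶-context : (a b : List (Fin n)) {w w′ : List (Fin n)} → w ⟶ w′ → a ++ w ++ b ⟶ a ++ w′ ++ b
  ⟶-context a b (a′ , b′ , u , v , refl , refl , con) =
    a ++ a′ , b′ ++ b , u , v , reassoc u , reassoc v , con
    where
    reassoc : ∀ x → a ++ (a′ ++ x ++ b′) ++ b ≡ (a ++ a′) ++ x ++ b′ ++ b
    reassoc x = trans
      (cong (a ++_) (trans (List.++-assoc a′ (x ++ b′) b) (cong (a′ ++_) (List.++-assoc x b′ b))))
      (sym (List.++-assoc a a′ (x ++ b′ ++ b)))

  ⟶-map : (g : Fin m → Fin n) → Monotone g → ∀ {w w′} → w ⟶ w′ → map g w ⟶ map g w′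
  ⟶-map g mono (a , b , u , v , refl , refl , con) =
    map g a , map g b , map g u , map g v , map-infix u , map-infix v , contract-map g mono con
    where
    map-infix : ∀ x → map g (a ++ x ++ b) ≡ map g a ++ map g x ++ map g b
    map-infix x = trans (List.map-++ g a (x ++ b)) (cong (map g a ++_) (List.map-++ g x b))

  ⟶-unmap : (g : Fin m → Fin n) → Monotone g → ∀ w {w″} → map g w ⟶ w″ →
            ∃[ w′ ] w″ ≡ map g w′ × w ⟶ w′
  ⟶-unmap g mono w (a , b , u , v , p , refl , con)
    with a′ , ub , refl , refl , q ← map≡++ g w a p
    with u′ , b′ , refl , refl , refl ← map≡++ g ub u (sym q)
    with v′ , refl , con′ ← contract-unmap g mono u′ con =
      a′ ++ v′ ++ b′ ,
      sym (trans (List.map-++ g a′ (v′ ++ b′)) (cong (map g a′ ++_) (List.map-++ g v′ b′))) ,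
      (a′ , b′ , u′ , v′ , refl , refl , con′)

  -- Reducible words are the words that contain a pattern of U

  -- π is the order permutation of some factor of w.
  Occurs : Permutation′ c → List (Fin n) → Set
  Occurs {n} π w = ∃[ a ] ∃[ b ] Σ (Vec (Fin n) c) λ u →
    w ≡ a ++ toList u ++ b × IsOrderPermutation π u

  occurs? : (π : Permutation′ c) (w : List (Fin n)) → Dec (Occurs π w)
  occurs? π w = map′
    (λ (a , b , u , _ , p , _ , r) → a , b , u , p , r)
    (λ (a , b , u , p , r) → a , b , u , u , p , p , r)
    (sameContext? Fin._≟_ (λ u _ → isOrderPermutation? π u) w w)

  Reducible : List (Fin n) → Set
  Reducible w = ∃[ w′ ] w ⟶ w′

  occurs⇒reducible : {w : List (Fin n)} → (∃[ π ] U P π × Occurs π w) → Reducible w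
  occurs⇒reducible (π , π∈U , a , b , u , w≡ , ord)
    with τ , s , τ<π ← U⇒smaller π π∈U
       | e , mono , u≡ ← orderPermutation⇒spell π u ord =
    a ++ spell e τ ++ b , a , b , toList u , spell e τ , w≡ , refl ,
    π , τ , e , mono , s , τ<π , u≡ , refl

  reducible⇒occurs : {w : List (Fin n)} → Reducible w → ∃[ π ] U P π × Occurs π w
  reducible⇒occurs (_ , a , b , _ , _ , w≡ , _ , σ , τ , e , mono , s , τ<σ , refl , _)
    with u , u≡ , ord ← spell⇒orderPermutation e mono σ =
    σ , smaller⇒U {σ} {τ} s τ<σ , a , b , u , trans w≡ (cong (λ x → a ++ x ++ b) (sym u≡)) , ord

  reducible? : (w : List (Fin n)) → Dec (Reducible w)
  reducible? w = map′ occurs⇒reducible reducible⇒occurs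
    (∃? (Sₙ c) (perms-enumerates c) {Q = λ π → U P π × Occurs π w}
      (λ {π} {π′} e (π∈U , a , b , u , p , r) →
        U-resp P {π} {π′} e π∈U , a , b , u , p , isOrderPermutation-resp u {π} {π′} e r)
      (λ π → ¬? (D? P π) ×-dec occurs? π w))

  -- Rewriting of permutations

  -- w uses each of the n letters exactly once.
  Arranged : List (Fin n) → Set
  Arranged {n} w = w ↭ allFin n

  -- Oriented moves between permutations.  All other words are kept as isolated
  -- points, so that confluence can be stated for the type of all words.
  _⇒_ : Rel (List (Fin n)) 0ℓ
  w ⇒ w′ = Arranged w × w ⟶ w′

  _—↠_ : Rel (List (Fin n)) 0ℓ
  _—↠_ = Star _⇒_

  ⇒-arranged : {w w′ : List (Fin n)} → w ⇒ w′ → Arranged w′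
  ⇒-arranged (p , r) = ↭-trans (↭-sym (⟶-↭ r)) p

  ⟶*⇒—↠ : {w w′ : List (Fin n)} → Arranged w → Star _⟶_ w w′ → w —↠ w′
  ⟶*⇒—↠ p ε        = ε
  ⟶*⇒—↠ p (r ◅ rs) = (p , r) ◅ ⟶*⇒—↠ (⇒-arranged (p , r)) rs

  arranged? : (w : List (Fin n)) → Dec (Arranged w)
  arranged? {n} w = map′ (λ { (π , refl) → word-↭ π }) ↭-word
    (∃? (Sₙ n) (perms-enumerates n) {Q = λ π → word π ≡ w}
      (λ {π} {τ} e p → trans (sym (word-cong π τ e)) p) (λ π → List.≡-dec Fin._≟_ (word π) w))

  ⇒-stronglyNormalizing : StronglyNormalizing (Plus (_⇒_ {n}))
  ⇒-stronglyNormalizing = WF.Subrelation.wellFounded decreasing (On.wellFounded value <-wellFounded)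
    where
    decreasing : {w′ w : List (Fin n)} → Plus _⇒_ w w′ → value w′ ℕ.< value w
    decreasing Plus.[ _ , r ]      = ⟶-value r
    decreasing (_ ∼⁺⟨ p ⟩ q) = ℕ.<-trans (decreasing q) (decreasing p)

  ⇒-weaklyNormalizing : WeaklyNormalizing (_⇒_ {n})
  ⇒-weaklyNormalizing {n} w = go w (⇒-stronglyNormalizing w)
    where
    go : ∀ w → WF.Acc (flip (Plus _⇒_)) w → HasNormalForm (_⇒_ {n}) w
    go w (WF.acc rec) with arranged? w ×-dec reducible? w
    ... | yes (p , w′ , r) = let v , nf , rs = go w′ (rec Plus.[ p , r ]) in v , nf , (p , r) ◅ rs
    ... | no ¬r            = w , (λ (w′ , p , r) → ¬r (p , w′ , r)) , ε

  -- P-equivalence, avoiders and normal forms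

  -- Equivalence generated by oriented moves; between permutations this is
  -- P-equivalence (pEquivalence⇒↔, ↔⇒pEquivalence).
  _↔_ : Rel (List (Fin n)) 0ℓ
  _↔_ = EqClosure _⇒_

  move⇒↔ : (φ ψ : Permutation′ n) → Move P φ ψ → word φ ↔ word ψ
  move⇒↔ {n} φ ψ (a , b , u , v , φ≡ , ψ≡ , σ , τ , ord-u , ord-v , s)
    with e , e-mono , u≡ ← orderPermutation⇒spell σ u ord-u
       | f , f-mono , v≡ ← orderPermutation⇒spell τ v ord-v = steps (<ₗₑₓ-compare σ τ)
    where
    spell-e↭f : spell e σ ↭ spell f τ
    spell-e↭f = subst₂ _↭_ u≡ v≡
      (infix-↭ a (subst₂ _↭_ φ≡ ψ≡ (↭-trans (word-↭ φ) (↭-sym (word-↭ ψ)))))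

    e≗f : ∀ i → e i ≡ f i
    e≗f = monotone-unique e f e-mono f-mono
      (↭-trans (↭-sym (spell-↭ e σ)) (↭-trans spell-e↭f (spell-↭ f τ)))

    φ≡′ : word φ ≡ a ++ spell e σ ++ b
    φ≡′ = trans φ≡ (cong (λ x → a ++ x ++ b) u≡)

    ψ≡′ : word ψ ≡ a ++ spell e τ ++ b
    ψ≡′ = trans ψ≡ (cong (λ x → a ++ x ++ b)
      (trans v≡ (List.tabulate-cong λ i → sym (e≗f (τ ⟨$⟩ʳ i)))))

    -- When the two patterns are equal the two words are equal as well.
    steps : σ <ₗₑₓ τ ⊎ σ ≈ τ ⊎ τ <ₗₑₓ σ → word φ ↔ word ψ
    steps (inj₁ σ<τ) = bwd
      (word-↭ ψ , a , b , _ , _ , ψ≡′ , φ≡′ , τ , σ , e , e-mono , SamePart-sym s , σ<τ , refl , refl) ◅ ε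
    steps (inj₂ (inj₂ τ<σ)) = fwd
      (word-↭ φ , a , b , _ , _ , φ≡′ , ψ≡′ , σ , τ , e , e-mono , s , τ<σ , refl , refl) ◅ ε
    steps (inj₂ (inj₁ σ≈τ)) = subst (word φ ↔_)
      (trans φ≡′ (trans (cong (λ x → a ++ x ++ b) (List.tabulate-cong (cong e ∘ σ≈τ))) (sym ψ≡′))) ε

  ⟶⇒move : (φ ψ : Permutation′ n) → word φ ⟶ word ψ → Move P φ ψ
  ⟶⇒move φ ψ (a , b , _ , _ , φ≡ , ψ≡ , σ , τ , e , mono , s , _ , refl , refl)
    with u , u≡ , ord-u ← spell⇒orderPermutation e mono σ
       | v , v≡ , ord-v ← spell⇒orderPermutation e mono τ =
    a , b , u , v , trans φ≡ (cong (λ x → a ++ x ++ b) (sym u≡)) ,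
    trans ψ≡ (cong (λ x → a ++ x ++ b) (sym v≡)) ,
    σ , τ , ord-u , ord-v , s

  pEquivalence⇒↔ : (φ ψ : Permutation′ n) → PEquivalence P φ ψ → word φ ↔ word ψ
  pEquivalence⇒↔ φ ψ = Eq.gfold (Eq.isEquivalence _⇒_) word λ
    { {φ} {ψ} (inj₁ φ≈ψ) → subst (word φ ↔_) (word-cong φ ψ φ≈ψ) ε
    ; {φ} {ψ} (inj₂ m)   → move⇒↔ φ ψ m }

  ↔⇒pEquivalence : (φ ψ : Permutation′ n) → word φ ↔ word ψ → PEquivalence P φ ψ
  ↔⇒pEquivalence {n} φ ψ r = go r φ refl refl
    where
    go : ∀ {w w′} → w ↔ w′ → ∀ φ → word φ ≡ w → word ψ ≡ w′ → PEquivalence P φ ψ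
    go ε φ φ≡ ψ≡ = fwd (inj₁ (word-injective φ ψ (trans φ≡ (sym ψ≡)))) ◅ ε
    go (fwd r ◅ rs) φ refl ψ≡ with χ , refl ← ↭-word (⇒-arranged r) =
      fwd (inj₂ (⟶⇒move φ χ (proj₂ r))) ◅ go rs χ refl ψ≡
    go (bwd r ◅ rs) φ refl ψ≡ with χ , refl ← ↭-word (proj₁ r) =
      bwd (inj₂ (⟶⇒move χ φ (proj₂ r))) ◅ go rs χ refl ψ≡

  avoidsU⇒normalForm : {φ : Permutation′ n} → AvoidsU P φ → IsNormalForm _⇒_ (word φ)
  avoidsU⇒normalForm avoids (w , _ , r) =
    let π , π∈U , occ = reducible⇒occurs (w , r) in avoids π π∈U occ

  normalForm⇒avoidsU : {φ : Permutation′ n} → IsNormalForm _⇒_ (word φ) → AvoidsU P φ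
  normalForm⇒avoidsU {φ = φ} nf π π∈U occ =
    let w , r = occurs⇒reducible (π , π∈U , occ) in nf (w , word-↭ φ , r)

  —↠-arranged : {w w′ : List (Fin n)} → w ↭ allFin n → w —↠ w′ → w′ ↭ allFin n
  —↠-arranged p ε        = p
  —↠-arranged p (r ◅ rs) = —↠-arranged (⇒-arranged r) rs

  -- Each P-class contains an avoider.
  normalize : (φ : Permutation′ n) →
              Σ (Σ (Permutation′ n) (AvoidsU P)) λ x → PEquivalence P (proj₁ x) φ
  normalize φ with ⇒-weaklyNormalizing (word φ)
  ... | w , nf , rs with ψ , refl ← ↭-word (—↠-arranged (word-↭ φ) rs) =
    (ψ , normalForm⇒avoidsU {φ = ψ} nf) , ↔⇒pEquivalence ψ φ (Eq.symmetric _⇒_ (a—↠b⇒a↔b rs))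

  -- Confluence says that each P-class contains only one avoider.
  sameCount⇒confluent : numClasses P n ≡ numAvoiders P n → Confluent (_⇒_ {n})
  sameCount⇒confluent {n} eq = un&wn⇒cr uniqueNormalForm ⇒-weaklyNormalizing
    where
    uniqueAvoider : {x y : Σ (Permutation′ n) (AvoidsU P)} →
                    PEquivalence P (proj₁ x) (proj₁ y) → proj₁ x ≈ proj₁ y
    uniqueAvoider {x} {y} = sameSize⇒injective {Avoiders P n} {Classes P n}
      (avoiders-finite P n) (classes-finite P n)
      proj₁ (λ e → fwd (inj₁ e) ◅ ε) (proj₁ ∘ normalize) (proj₂ ∘ normalize) eq {x} {y}

    -- A word that is not a permutation is equivalent only to itself.
    arranged : ∀ {w w′} → w ↔ w′ → w ≡ w′ ⊎ (w ↭ allFin n × w′ ↭ allFin n)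
    arranged ε = inj₁ refl
    arranged (r ◅ rs) with arranged rs | r
    ... | inj₁ refl     | fwd r = inj₂ (proj₁ r , ⇒-arranged r)
    ... | inj₁ refl     | bwd r = inj₂ (⇒-arranged r , proj₁ r)
    ... | inj₂ (_ , p)  | fwd r = inj₂ (proj₁ r , p)
    ... | inj₂ (_ , p)  | bwd r = inj₂ (⇒-arranged r , p)

    uniqueNormalForm : UniqueNormalForm _⇒_
    uniqueNormalForm nf nf′ r with arranged r
    ... | inj₁ refl = refl
    ... | inj₂ (p , q) with φ , refl ← ↭-word p | ψ , refl ← ↭-word q =
      word-cong φ ψ (uniqueAvoider
        {φ , normalForm⇒avoidsU {φ = φ} nf} {ψ , normalForm⇒avoidsU {φ = ψ} nf′}
        (↔⇒pEquivalence φ ψ r))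

  confluent⇒sameCount : Confluent (_⇒_ {n}) → numClasses P n ≡ numAvoiders P n
  confluent⇒sameCount {n} confluent = injective⇒sameSize {Avoiders P n} {Classes P n}
    (avoiders-finite P n) (classes-finite P n)
    proj₁ (λ e → fwd (inj₁ e) ◅ ε) (proj₁ ∘ normalize) (proj₂ ∘ normalize)
    λ {(φ , avoids-φ)} {(ψ , avoids-ψ)} φ∼ψ → word-injective φ ψ
      (conf⇒unf confluent
        (avoidsU⇒normalForm {φ = φ} avoids-φ) (avoidsU⇒normalForm {φ = ψ} avoids-ψ)
        (pEquivalence⇒↔ φ ψ φ∼ψ))

  -- Local confluence

  -- w₁ and w₂ have a common reduct.
  Joinable : Rel (List (Fin n)) 0ℓ
  Joinable w₁ w₂ = ∃[ w ] (w₁ —↠ w) × (w₂ —↠ w)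

  -- Two steps inside a factor that is an increasing relabelling of a permutation
  -- of length n are joined by relabelling a join in length n.
  joinable-embed : Confluent (_⇒_ {n}) → (g : Fin n → Fin m) → Monotone g → (a b : List (Fin m)) →
                   ∀ {w x y} → w ↭ allFin n → a ++ map g w ++ b ↭ allFin m →
                   map g w ⟶ x → map g w ⟶ y → Joinable (a ++ x ++ b) (a ++ y ++ b)
  joinable-embed {n} {m} confluent g mono a b {w} p q r₁ r₂
    with x , refl , r₁ ← ⟶-unmap g mono w r₁
       | y , refl , r₂ ← ⟶-unmap g mono w r₂
    with z , s₁ , s₂ ← confluent ((p , r₁) ◅ ε) ((p , r₂) ◅ ε) =
    embed z , lift r₁ s₁ , lift r₂ s₂
    where
    embed : List (Fin n) → List (Fin m)
    embed v = a ++ map g v ++ b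

    embed-⟶ : ∀ {v v′} → v ⟶ v′ → embed v ⟶ embed v′
    embed-⟶ r = ⟶-context a b (⟶-map g mono r)

    lift : ∀ {v z} → w ⟶ v → v —↠ z → embed v —↠ embed z
    lift r rs = ⟶*⇒—↠ (↭-trans (↭-sym (⟶-↭ (embed-⟶ r))) q) (Star.gmap embed (embed-⟶ ∘ proj₂) rs)

  -- Contractions of disjoint factors commute.
  disjoint-joinable : {u u′ v v′ : List (Fin n)} (m : List (Fin n)) →
    u ++ m ++ v ↭ allFin n → Contract u u′ → Contract v v′ →
    Joinable (u′ ++ m ++ v) (u ++ m ++ v′)
  disjoint-joinable {u = u} {u′} {v} {v′} m p con-u con-v =
    u′ ++ m ++ v′ , (⇒-arranged (p , left v) , right u′) ◅ ε ,
    (⇒-arranged (p , right u) , left v′) ◅ ε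
    where
    left : ∀ x → u ++ m ++ x ⟶ u′ ++ m ++ x
    left x = [] , m ++ x , u , u′ , refl , refl , con-u

    right : ∀ x → x ++ m ++ v ⟶ x ++ m ++ v′
    right x = x ++ m , [] , v , v′ , assoc v , assoc v′ , con-v
      where
      assoc : ∀ y → x ++ m ++ y ≡ (x ++ m) ++ y ++ []
      assoc y = trans (sym (List.++-assoc x m y)) (cong ((x ++ m) ++_) (sym (List.++-identityʳ y)))

  joinable-sym : {w w′ : List (Fin n)} → Joinable w w′ → Joinable w′ w
  joinable-sym (z , r , s) = z , s , r

  -- From length n to length n + 1

  module _ (2c≤ : 2 * c ≤ suc n) (confluent : Confluent (_⇒_ {n})) where

    -- Steps that both leave the first letter in place.
    joinable-∷ : (φ : Permutation′ (suc n))
                 {x₁ x₂ : Fin (suc n)} {w₁ w₂ w₁′ w₂′ : List (Fin (suc n))} →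
                 word φ ≡ x₁ ∷ w₁ → word φ ≡ x₂ ∷ w₂ → w₁ ⟶ w₁′ → w₂ ⟶ w₂′ →
                 Joinable (x₁ ∷ w₁′) (x₂ ∷ w₂′)
    joinable-∷ φ {w₁′ = w₁′} {w₂′} p q r₁ r₂
      with refl , refl ← List.∷-injective (trans (sym (word-remove-first φ)) p)
         | refl , refl ← List.∷-injective (trans (sym (word-remove-first φ)) q) =
      subst₂ Joinable (cong (_ ∷_) (List.++-identityʳ w₁′)) (cong (_ ∷_) (List.++-identityʳ w₂′))
        (joinable-embed confluent (punchIn x) (punchIn-monotone x) [ x ] [] (word-↭ φ′)
          (subst (_↭ allFin (suc n)) φ≡ (word-↭ φ)) r₁ r₂)
      where
      x = φ ⟨$⟩ʳ zero
      φ′ = Perm.remove zero φ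
      φ≡ : word φ ≡ x ∷ map (punchIn x) (word φ′) ++ []
      φ≡ = trans (word-remove-first φ) (cong (x ∷_) (sym (List.++-identityʳ _)))

    -- Steps that both leave the last letter in place.
    joinable-∷ʳ : (φ : Permutation′ (suc n))
                  {x₁ x₂ : Fin (suc n)} {w₁ w₂ w₁′ w₂′ : List (Fin (suc n))} →
                  word φ ≡ w₁ ∷ʳ x₁ → word φ ≡ w₂ ∷ʳ x₂ → w₁ ⟶ w₁′ → w₂ ⟶ w₂′ →
                  Joinable (w₁′ ∷ʳ x₁) (w₂′ ∷ʳ x₂)
    joinable-∷ʳ φ {w₁ = w₁} {w₂} p q r₁ r₂
      with refl , refl ← List.∷ʳ-injective _ w₁ (trans (sym (word-remove-last φ)) p)
         | refl , refl ← List.∷ʳ-injective _ w₂ (trans (sym (word-remove-last φ)) q) =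
      joinable-embed confluent (punchIn x) (punchIn-monotone x) [] [ x ]
        (word-↭ (Perm.remove (fromℕ n) φ))
        (subst (_↭ allFin (suc n)) (word-remove-last φ) (word-↭ φ)) r₁ r₂
      where
      x = φ ⟨$⟩ʳ fromℕ n

    length-word : (φ : Permutation′ (suc n)) → ∀ {w} → word φ ≡ w → length w ≡ suc n
    length-word φ refl = List.length-tabulate (φ ⟨$⟩ʳ_)

    -- The first window starts at the beginning of the word.  It cannot also reach
    -- the end, so b₁ is nonempty; if b₂ is nonempty too, both windows miss the last
    -- letter, and otherwise they are at opposite ends.
    joinable-start : (φ : Permutation′ (suc n)) (a b₁ b₂ : List (Fin (suc n)))
      {u₁ v₁ u₂ v₂ : List (Fin (suc n))} →
      word φ ≡ u₁ ++ b₁ → word φ ≡ a ++ u₂ ++ b₂ → Contract u₁ v₁ → Contract u₂ v₂ →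
      Joinable (v₁ ++ b₁) (a ++ v₂ ++ b₂)
    joinable-start φ a b₁ b₂ {u₁} {v₁} {u₂} {v₂} p q con₁ con₂ with initLast b₁ | initLast b₂
    ... | [] | _ = contradiction
      (trans (sym (contract-lengthˡ con₁))
        (trans (cong length (sym (List.++-identityʳ u₁))) (length-word φ p)))
      (ℕ.<⇒≢ (2*m≤1+n⇒m<1+n c 2c≤))
    ... | b₁′ ∷ʳ′ x₁ | [] = far
      where
      -- The second window is at the end, so a has suc n - c ≥ c letters.
      c≤a : length u₁ ≤ length a
      c≤a = ℕ.+-cancelʳ-≤ c _ _ (begin
        length u₁ + c                 ≡⟨ cong (_+ c) (contract-lengthˡ con₁) ⟩
        c + c                         ≡⟨ cong (c +_) (ℕ.+-identityʳ c) ⟨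
        2 * c                         ≤⟨ 2c≤ ⟩
        suc n                         ≡⟨ length-word φ q ⟨
        length (a ++ u₂ ++ [])        ≡⟨ List.length-++ a ⟩
        length a + length (u₂ ++ [])  ≡⟨ cong (λ x → length a + length x) (List.++-identityʳ u₂) ⟩
        length a + length u₂          ≡⟨ cong (length a +_) (contract-lengthˡ con₂) ⟩
        length a + c                  ∎)
        where open ℕ.≤-Reasoning

      far : Joinable (v₁ ++ b₁′ ∷ʳ x₁) (a ++ v₂ ++ [])
      far with m , refl , b₁≡ ← ++≡++ u₁ a c≤a (trans (sym p) q) =
        subst₂ Joinable
          (cong (v₁ ++_) (trans (cong (m ++_) (sym (List.++-identityʳ u₂))) (sym b₁≡)))
          (trans (sym (List.++-assoc u₁ m v₂)) (cong ((u₁ ++ m) ++_) (sym (List.++-identityʳ v₂))))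
          (disjoint-joinable m
            (subst (_↭ allFin (suc n))
              (trans p (cong (u₁ ++_) (trans b₁≡ (cong (m ++_) (List.++-identityʳ u₂)))))
              (word-↭ φ))
            con₁ con₂)
    ... | b₁′ ∷ʳ′ x₁ | b₂′ ∷ʳ′ x₂ =
      subst₂ Joinable (List.++-assoc v₁ b₁′ _) (assoc v₂)
        (joinable-∷ʳ φ (trans p (sym (List.++-assoc u₁ b₁′ _))) (trans q (sym (assoc u₂)))
          ([] , b₁′ , u₁ , v₁ , refl , refl , con₁) (a , b₂′ , u₂ , v₂ , refl , refl , con₂))
      where
      assoc : ∀ u → (a ++ u ++ b₂′) ∷ʳ x₂ ≡ a ++ u ++ b₂′ ∷ʳ x₂
      assoc u = trans (List.++-assoc a (u ++ b₂′) _) (cong (a ++_) (List.++-assoc u b₂′ _))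

    weaklyConfluent-suc : WeaklyConfluent (_⇒_ {suc n})
    weaklyConfluent-suc
      (p , a₁ , b₁ , u₁ , v₁ , w≡₁ , refl , con₁)
      (_ , a₂ , b₂ , u₂ , v₂ , w≡₂ , refl , con₂)
      with φ , refl ← ↭-word p = go a₁ a₂ w≡₁ w≡₂
      where
      go : ∀ a₁ a₂ → word φ ≡ a₁ ++ u₁ ++ b₁ → word φ ≡ a₂ ++ u₂ ++ b₂ →
           Joinable (a₁ ++ v₁ ++ b₁) (a₂ ++ v₂ ++ b₂)
      go []        a₂        p q = joinable-start φ a₂ b₁ b₂ p q con₁ con₂
      go (x₁ ∷ a₁) []        p q = joinable-sym (joinable-start φ (x₁ ∷ a₁) b₂ b₁ q p con₂ con₁)
      go (x₁ ∷ a₁) (x₂ ∷ a₂) p q = joinable-∷ φ p q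
        (a₁ , b₁ , u₁ , v₁ , refl , refl , con₁) (a₂ , b₂ , u₂ , v₂ , refl , refl , con₂)

    confluent-suc : Confluent (_⇒_ {suc n})
    confluent-suc = sn&wcr⇒cr ⇒-stronglyNormalizing weaklyConfluent-suc

  confluent-≥ : ∀ {k} → 2 * c ∸ 1 ≤ k → Confluent (_⇒_ {k}) →
                ∀ {n} → k ℕ.≤′ n → Confluent (_⇒_ {n})
  confluent-≥ 2c∸1≤k confluent ℕ.≤′-refl        = confluent
  confluent-≥ 2c∸1≤k confluent (ℕ.≤′-step k≤′n) =
    confluent-suc
      (ℕ.≤-trans (ℕ.m≤n+m∸n (2 * c) 1) (ℕ.s≤s (ℕ.≤-trans 2c∸1≤k (ℕ.≤′⇒≤ k≤′n))))
      (confluent-≥ 2c∸1≤k confluent k≤′n)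

theorem4p7 : (c : ℕ) → 1 ≤ c → (P : SetPartition (Sₙ c)) →
    (k : ℕ) → 2 * c ∸ 1 ≤ k →
    numClasses P k ≡ numAvoiders P k →
    ∀ n → k ≤ n → numClasses P n ≡ numAvoiders P n
theorem4p7 c _ P k 2c∸1≤k N≡A n k≤n =
  confluent⇒sameCount P (confluent-≥ P 2c∸1≤k (sameCount⇒confluent P N≡A) (ℕ.≤⇒≤′ k≤n))
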